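{- Let $2\le k\le n$ be integers and let $Y$ be a graph on $n$ vertices. Then the following are equivalent: (i) the friends-and-strangers graph $\mathsf{FS}(\mathsf{Lollipop}_{n-k,k},Y)$ is connected; (ii) every induced subgraph of $Y$ with exactly $k$ vertices is connected; (iii) $Y$ is $(n-k+1)$-connected.
   Context: All graphs are finite and simple (no loops, no multiple edges). Friends-and-strangers graph: for two graphs $X$ and $Y$, each with $n$ vertices, $\mathsf{FS}(X,Y)$ is the graph whose vertices are all bijections $\sigma:V(X)\to V(Y)$, where two bijections $\sigma,\sigma'$ are adjacent if and only if there is an edge $\{a,b\}\in E(X)$ such that $\{\sigma(a),\sigma(b)\}\in E(Y)$, $\sigma(a)=\sigma'(b)$, $\sigma(b)=\sigma'(a)$, and $\sigma(c)=\sigma'(c)$ for all $c\in V(X)\setminus\{a,b\}$. Lollipop graph: $\mathsf{Lollipop}_{n-k,k}$ is the graph of order $n$ obtained by identifying one end of a path with $n-k+1$ vertices with a vertex of a complete graph on $k$ vertices. Concretely, it has vertex set $\{1,\dots,n\}$, with edges $\{i,i+1\}$ for $1\le i\le n-k$ together with all edges $\{i,j\}$ with $n-k+1\le i<j\le n$. (For $k=n$ it is the complete graph on $n$ vertices.) Connectivity convention: a graph $G$ is $\ell$-connected if the graph obtained by removing any $\ell-1$ vertices from $G$ is still connected. -}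

module Defs where

open import Data.Fin using (Fin; toℕ)
open import Data.Fin.Permutation as Perm using (Permutation; _⟨$⟩ʳ_)
open import Data.Fin.Properties as Fin using (≡-setoid; any?; all?)
open import Data.Fin.Subset using (Subset; _∈_; ∁; ∣_∣)
open import Data.Nat as ℕ using (ℕ; suc; _∸_; _≤_; _<_)
open import Data.Nat.Properties as ℕₚ using (<⇒≢)
open import Data.Product using (∃; ∃-syntax; _×_; _,_; proj₁)
open import Data.Sum using (_⊎_; inj₁; inj₂)
open import Level using (0ℓ)
open import Relation.Binary.Bundles using (Setoid)
open import Relation.Binary.Construct.Closure.ReflexiveTransitive using (Star)
open import Relation.Binary.Construct.Closure.Symmetric as Sym using (SymClosure; fwd; bwd)
import Relation.Binary.Construct.On as On
open import Relation.Binary.Core using (Rel)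
open import Relation.Binary.Definitions
  using (Symmetric; Irreflexive; Decidable; _Respects₂_)
open import Relation.Binary.PropositionalEquality
  using (_≡_; _≢_; refl; sym; trans; subst₂)
open import Relation.Nullary.Decidable using (map′; ¬?; _×-dec_; _⊎-dec_; _→-dec_)

-- Vertices form a setoid rather than a bare type because the vertices of
-- FS X Y are bijections, which without function extensionality must be
-- compared pointwise, and those of an induced subgraph are elements paired
-- with membership proofs, which must be ignored.
record Graph (V : Setoid 0ℓ 0ℓ) : Set₁ where
  open Setoid V using (_≈_) renaming (Carrier to Vertex)
  field
    Adj        : Rel Vertex 0ℓ
    adj-resp   : Adj Respects₂ _≈_
    adj-sym    : Symmetric Adj
    adj-irrefl : Irreflexive _≈_ Adj
    adj?       : Decidable Adj

open Graph public

GraphOn : ℕ → Set₁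
GraphOn n = Graph (≡-setoid n)

-- The empty graph counts as connected here.
Connected : {V : Setoid 0ℓ 0ℓ} → Graph V → Set
Connected {V} G = ∀ u v → ∃[ w ] Star (Adj G) u w × w ≈ v
  where open Setoid V using (_≈_)

subsetSetoid : ∀ {n} → Subset n → Setoid 0ℓ 0ℓ
subsetSetoid {n} S = On.setoid {B = ∃ (_∈ S)} (≡-setoid n) proj₁

induced : ∀ {n} → GraphOn n → (S : Subset n) → Graph (subsetSetoid S)
induced G S = record
  { Adj        = λ u v → Adj G (proj₁ u) (proj₁ v)
  ; adj-resp   = (λ { refl p → p }) , (λ { refl p → p })
  ; adj-sym    = adj-sym G
  ; adj-irrefl = adj-irrefl G
  ; adj?       = λ u v → adj? G (proj₁ u) (proj₁ v)
  }

remove : ∀ {n} → GraphOn n → (S : Subset n) → Graph (subsetSetoid (∁ S))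
remove G S = induced G (∁ S)

-- The removed set has exactly ℓ - 1 elements; in particular no condition
-- |V(G)| > ℓ is imposed, and every graph is 0-connected.
_-Connected_ : ∀ {n} → ℕ → GraphOn n → Set
ℓ -Connected G = ∀ S → suc ∣ S ∣ ≡ ℓ → Connected (remove G S)

-- The edges {i, j} of Lollipop_{n-k,k} with i < j, in terms of the labels
-- 1, …, n.
LollipopEdge : ℕ → ℕ → ℕ → ℕ → Set
LollipopEdge n k i j =
  (i ≤ n ∸ k × j ≡ suc i) ⊎ (suc (n ∸ k) ≤ i × i < j)

label : ∀ {n} → Fin n → ℕ
label v = suc (toℕ v)

-- Lollipop n k is Lollipop_{n-k,k}, of order n; meaningful for k ≤ n.
Lollipop : (n k : ℕ) → GraphOn n
Lollipop n k = record
  { Adj        = SymClosure Edge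
  ; adj-resp   = (λ { refl p → p }) , (λ { refl p → p })
  ; adj-sym    = Sym.symmetric Edge
  ; adj-irrefl = λ { refl (fwd e) → <⇒≢ (edge⇒< e) refl
                   ; refl (bwd e) → <⇒≢ (edge⇒< e) refl }
  ; adj?       = λ u v → map′ (λ { (inj₁ e) → fwd e ; (inj₂ e) → bwd e })
                              (λ { (fwd e) → inj₁ e ; (bwd e) → inj₂ e })
                              (edge? u v ⊎-dec edge? v u)
  }
  where
  Edge : Rel (Fin n) 0ℓ
  Edge u v = LollipopEdge n k (label u) (label v)

  edge⇒< : ∀ {i j} → LollipopEdge n k i j → i < j
  edge⇒< (inj₁ (_ , refl)) = ℕₚ.≤-refl
  edge⇒< (inj₂ (_ , i<j))  = i<j

  edge? : Decidable Edge
  edge? u v =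
    (label u ℕ.≤? n ∸ k ×-dec label v ℕ.≟ suc (label u)) ⊎-dec
    (suc (n ∸ k) ℕ.≤? label u ×-dec label u ℕ.<? label v)

bijections : ℕ → Setoid 0ℓ 0ℓ
bijections n = record
  { Carrier       = Permutation n n
  ; _≈_           = Perm._≈_
  ; isEquivalence = record
    { refl  = λ _ → refl
    ; sym   = λ p i → sym (p i)
    ; trans = λ p q i → trans (p i) (q i)
    }
  }

FSAdj : ∀ {n} → GraphOn n → GraphOn n → Rel (Permutation n n) 0ℓ
FSAdj X Y σ σ′ = ∃[ a ] ∃[ b ]
    Adj X a b
  × Adj Y (σ ⟨$⟩ʳ a) (σ ⟨$⟩ʳ b)
  × σ ⟨$⟩ʳ a ≡ σ′ ⟨$⟩ʳ b
  × σ ⟨$⟩ʳ b ≡ σ′ ⟨$⟩ʳ a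
  × (∀ c → c ≢ a → c ≢ b → σ ⟨$⟩ʳ c ≡ σ′ ⟨$⟩ʳ c)

FS : ∀ {n} → GraphOn n → GraphOn n → Graph (bijections n)
FS X Y = record
  { Adj        = FSAdj X Y
  ; adj-resp   =
      (λ { p (a , b , x , y , ab , ba , cc) →
           a , b , x , y , trans ab (p b) , trans ba (p a) ,
           λ c c≢a c≢b → trans (cc c c≢a c≢b) (p c) }) ,
      (λ { p (a , b , x , y , ab , ba , cc) →
           a , b , x , subst₂ (Adj Y) (p a) (p b) y ,
           trans (sym (p a)) ab , trans (sym (p b)) ba ,
           λ c c≢a c≢b → trans (sym (p c)) (cc c c≢a c≢b) })
  ; adj-sym    =
      λ { (a , b , x , y , ab , ba , cc) →
          a , b , x , subst₂ (Adj Y) ba ab (adj-sym Y y) , sym ba , sym ab ,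
          λ c c≢a c≢b → sym (cc c c≢a c≢b) }
  ; adj-irrefl =
      λ { p (a , b , _ , y , ab , _) → adj-irrefl Y (trans ab (sym (p b))) y }
  ; adj?       = λ σ σ′ → any? λ a → any? λ b →
      adj? X a b
      ×-dec adj? Y (σ ⟨$⟩ʳ a) (σ ⟨$⟩ʳ b)
      ×-dec (σ ⟨$⟩ʳ a Fin.≟ σ′ ⟨$⟩ʳ b)
      ×-dec (σ ⟨$⟩ʳ b Fin.≟ σ′ ⟨$⟩ʳ a)
      ×-dec all? λ c → ¬? (c Fin.≟ a) →-dec ¬? (c Fin.≟ b) →-dec
                       (σ ⟨$⟩ʳ c Fin.≟ σ′ ⟨$⟩ʳ c)
  }

{-# OPTIONS --safe #-}
module Submission where

-- Read σ as seating the person σ a at the vertex a of the lollipop.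
--
-- If |S| = k, consider the member of S sitting lowest. At most n - k people
-- are outside S, so this member sits on the path and no member of S behind can
-- overtake except by exchanging places with it, which requires a Y-edge inside
-- S. Its component in Y[S] is thus constant on components of FS, and any member
-- of S can be seated lowest.
--
-- Conversely, if all induced subgraphs of order k are connected, so is the
-- subgraph induced by the people beyond the first j seats, for j ≤ n - k. By
-- downward induction on j, seatings that agree on the first j seats are joined
-- in FS. On the complete part, two people at the ends of a Y-walk are
-- transposed by conjugation along the walk. On the path, the person needed at
-- seat j is brought there along a Y-walk from its present occupant, using the
-- induction hypothesis to place the next person of the walk at seat j + 1.

open import Defs
open import Algebra.Lattice.Properties.BooleanAlgebra using (¬-involutive)
open import Data.Fin using (Fin; zero; suc; toℕ; fromℕ<; inject≤; _↑ʳ_)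
open import Data.Fin.Permutation as Perm
  using (Permutation; _⟨$⟩ʳ_; _⟨$⟩ˡ_; _∘ₚ_; transpose; inverseˡ; inverseʳ)
open import Data.Fin.Properties as Finₚ
  using (_≟_; toℕ-injective; toℕ<n; toℕ-fromℕ<; toℕ-inject≤; toℕ-↑ʳ)
open import Data.Fin.Subset
  using (Subset; ∣_∣; _∈_; _∉_; _⊆_; _∪_; ∁; ⁅_⁆; inside; outside)
open import Data.Fin.Subset.Properties
  using ( _∈?_; ∪-∩-booleanAlgebra; ∣∁p∣≡n∸∣p∣; ∣⁅x⁆∣≡1; x∈⁅x⁆; p⊆p∪q; q⊆p∪q; x∈p∪q⁻
        ; x∈⁅y⁆⇒x≡y; x∈p∧x≢y⇒x∈p-y; x∈p⇒∣p-x∣<∣p∣; x∉p⇒x∈∁p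
        ; drop-∷-⊆; out⊆; s⊆s)
open import Data.Nat using (ℕ; zero; suc; _+_; _∸_; _≤_; _<_; z≤n; s≤s; s≤s⁻¹)
open import Data.Nat.Properties hiding (_≟_)
open import Data.Product using (∃-syntax; _×_; _,_; proj₁; proj₂)
open import Data.Sum using (inj₁; inj₂; [_,_]′)
open import Data.Vec using ([]; _∷_; here; there; tabulate)
open import Data.Vec.Properties using (lookup∘tabulate; lookup⇒[]=; []=⇒lookup)
open import Function using (_∘_)
open import Function.Bundles using (_⇔_; mk⇔)
open import Function.Definitions using (Injective)
open import Level using (0ℓ)
open import Relation.Binary.Bundles using (Setoid)
open import Relation.Binary.Construct.Closure.ReflexiveTransitive as Star
  using (Star; ε; _◅_; _◅◅_)
open import Relation.Binary.Construct.Closure.Symmetric using (fwd; bwd)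
open import Relation.Binary.Core using (Rel)
open import Relation.Binary.Definitions using (tri<; tri≈; tri>)
open import Relation.Binary.PropositionalEquality
open import Relation.Nullary using (Dec; yes; no; does; contradiction)
open import Relation.Nullary.Decidable using (dec-true; dec-false)
open import Relation.Unary using (Pred; Decidable)

-- Finite subsets

injection⇒≤∣S∣ : ∀ {m n} {S : Subset n} {f : Fin m → Fin n} →
                 Injective _≡_ _≡_ f → (∀ i → f i ∈ S) → m ≤ ∣ S ∣
injection⇒≤∣S∣ {zero}  _     _    = z≤n
injection⇒≤∣S∣ {suc m} {f = f} f-inj f∈S = <-≤-trans
  (s≤s (injection⇒≤∣S∣ (Finₚ.suc-injective ∘ f-inj)
    λ i → x∈p∧x≢y⇒x∈p-y (f∈S (suc i)) (Finₚ.0≢1+n ∘ sym ∘ f-inj)))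
  (x∈p⇒∣p-x∣<∣p∣ (f∈S zero))

∣p∪q∣≤∣p∣+∣q∣ : ∀ {n} (p q : Subset n) → ∣ p ∪ q ∣ ≤ ∣ p ∣ + ∣ q ∣
∣p∪q∣≤∣p∣+∣q∣ []            []            = z≤n
∣p∪q∣≤∣p∣+∣q∣ (outside ∷ p) (outside ∷ q) = ∣p∪q∣≤∣p∣+∣q∣ p q
∣p∪q∣≤∣p∣+∣q∣ (outside ∷ p) (inside  ∷ q) =
  ≤-trans (s≤s (∣p∪q∣≤∣p∣+∣q∣ p q)) (≤-reflexive (sym (+-suc ∣ p ∣ ∣ q ∣)))
∣p∪q∣≤∣p∣+∣q∣ (inside  ∷ p) (outside ∷ q) = s≤s (∣p∪q∣≤∣p∣+∣q∣ p q)
∣p∪q∣≤∣p∣+∣q∣ (inside  ∷ p) (inside  ∷ q) =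
  s≤s (≤-trans (∣p∪q∣≤∣p∣+∣q∣ p q) (+-monoʳ-≤ ∣ p ∣ (n≤1+n ∣ q ∣)))

-- An element of `q` outside `p` is discarded as long as `k` elements of `q` remain; once none can
-- be spared, `r` is all of `q`.
interpolate : ∀ {n k} {p q : Subset n} → p ⊆ q → ∣ p ∣ ≤ k → k ≤ ∣ q ∣ →
              ∃[ r ] p ⊆ r × r ⊆ q × ∣ r ∣ ≡ k
interpolate {p = []} {[]} _ _ z≤n = [] , (λ ()) , (λ ()) , refl
interpolate {p = inside ∷ p} {outside ∷ q} p⊆q = contradiction (p⊆q here) λ ()
interpolate {p = outside ∷ p} {outside ∷ q} p⊆q p≤k k≤q
  with r , p⊆r , r⊆q , eq ← interpolate (drop-∷-⊆ p⊆q) p≤k k≤q =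
  outside ∷ r , s⊆s p⊆r , s⊆s r⊆q , eq
interpolate {p = inside ∷ p} {inside ∷ q} p⊆q (s≤s p≤k) (s≤s k≤q)
  with r , p⊆r , r⊆q , eq ← interpolate (drop-∷-⊆ p⊆q) p≤k k≤q =
  inside ∷ r , s⊆s p⊆r , s⊆s r⊆q , cong suc eq
interpolate {p = outside ∷ p} {inside ∷ q} p⊆q p≤k k≤1+q with m≤n⇒m<n∨m≡n k≤1+q
... | inj₂ refl =
  inside ∷ q , out⊆ (drop-∷-⊆ p⊆q) , s⊆s (λ x∈q → x∈q) , refl
... | inj₁ (s≤s k≤q)
  with r , p⊆r , r⊆q , eq ← interpolate (drop-∷-⊆ p⊆q) p≤k k≤q =
  outside ∷ r , s⊆s p⊆r , out⊆ r⊆q , eq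

module _ {n} {P : Pred (Fin n) 0ℓ} (P? : Decidable P) where

  filter : Subset n
  filter = tabulate (does ∘ P?)

  ∈-filter⁺ : ∀ {x} → P x → x ∈ filter
  ∈-filter⁺ {x} px = lookup⇒[]= x filter
    (trans (lookup∘tabulate _ x) (dec-true (P? x) px))

  ∈-filter⁻ : ∀ {x} → x ∈ filter → P x
  ∈-filter⁻ {x} x∈ with P? x | trans (sym (lookup∘tabulate (does ∘ P?) x)) ([]=⇒lookup x∈)
  ... | yes px | _ = px
  ... | no  _  | ()

-- Transpositions

module _ {n} (i j : Fin n) where

  transpose-fst : transpose i j ⟨$⟩ʳ i ≡ j
  transpose-fst rewrite dec-true (i ≟ i) refl = refl

  transpose-snd : transpose i j ⟨$⟩ʳ j ≡ i
  transpose-snd with j ≟ i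
  ... | yes j≡i = j≡i
  ... | no  _ rewrite dec-true (j ≟ j) refl = refl

  transpose-fix : ∀ {k} → k ≢ i → k ≢ j → transpose i j ⟨$⟩ʳ k ≡ k
  transpose-fix {k} k≢i k≢j
    rewrite dec-false (k ≟ i) k≢i | dec-false (k ≟ j) k≢j = refl

-- Induction step for exchanging the ends of a walk: the exchange of `u` with the next vertex `w`
-- conjugates the shorter exchange of `w` and `v`.
transpose-conj : ∀ {n} {u v w : Fin n} → u ≢ v → w ≢ u → w ≢ v →
  transpose u w ∘ₚ transpose w v ∘ₚ transpose u w Perm.≈ transpose u v
transpose-conj {u = u} {v} {w} u≢v w≢u w≢v x = cases (x ≟ u) (x ≟ v) (x ≟ w)
  where
  chain : ∀ {y z r} → transpose u w ⟨$⟩ʳ x ≡ y → transpose w v ⟨$⟩ʳ y ≡ z →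
          transpose u w ⟨$⟩ʳ z ≡ r → transpose u v ⟨$⟩ʳ x ≡ r →
          (transpose u w ∘ₚ transpose w v ∘ₚ transpose u w) ⟨$⟩ʳ x ≡ transpose u v ⟨$⟩ʳ x
  chain refl refl p q = trans p (sym q)

  cases : Dec (x ≡ u) → Dec (x ≡ v) → Dec (x ≡ w) → _
  cases (yes refl) _ _ = chain (transpose-fst x w) (transpose-fst w v)
    (transpose-fix x w (u≢v ∘ sym) (w≢v ∘ sym)) (transpose-fst x v)
  cases (no x≢u) (yes refl) _ = chain (transpose-fix u w x≢u (w≢v ∘ sym)) (transpose-snd w x)
    (transpose-snd u w) (transpose-snd u x)
  cases (no x≢u) (no x≢v) (yes refl) = chain (transpose-snd u x)
    (transpose-fix x v (w≢u ∘ sym) u≢v) (transpose-fst u x) (transpose-fix u v x≢u x≢v)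
  cases (no x≢u) (no x≢v) (no x≢w) = chain (transpose-fix u w x≢u x≢w)
    (transpose-fix w v x≢w x≢v) (transpose-fix u w x≢u x≢w) (transpose-fix u v x≢u x≢v)

-- Walks

module _ {V : Setoid 0ℓ 0ℓ} (G : Graph V) where
  open Setoid V using (_≈_) renaming (Carrier to Vertex; refl to ≈-refl)

  -- The relation under `Connected`, as a record so that both ends can be inferred even where `_≈_`
  -- unfolds to pointwise equality.
  record Joined (u v : Vertex) : Set where
    constructor joined
    field
      {end} : Vertex
      path  : Star (Adj G) u end
      end≈  : end ≈ v

  joined-step : ∀ {u v} → Adj G u v → Joined u v
  joined-step e = joined (e ◅ ε) ≈-refl

module _ {V : Setoid 0ℓ 0ℓ} {G : Graph V} where
  open Setoid V using (_≈_) renaming (sym to ≈-sym; trans to ≈-trans)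

  -- The equality is absorbed by the first edge, or by `end≈` on an empty walk; so walks that end
  -- only up to `_≈_` still compose.
  joined-resp : ∀ {u v w} → u ≈ v → Joined G v w → Joined G u w
  joined-resp u≈v (joined ε eq)        = joined ε (≈-trans u≈v eq)
  joined-resp u≈v (joined (e ◅ es) eq) =
    joined (proj₂ (adj-resp G) (≈-sym u≈v) e ◅ es) eq

  joined-trans : ∀ {u v w} → Joined G u v → Joined G v w → Joined G u w
  joined-trans (joined es eq) vw with joined es′ eq′ ← joined-resp eq vw =
    joined (es ◅◅ es′) eq′

module _ {n} (Y : GraphOn n) where

  -- Membership is carried by the steps, so walks run between bare vertices and an empty walk
  -- demands nothing of its vertex.
  Within : Pred (Fin n) 0ℓ → Rel (Fin n) 0ℓ
  Within P u v = P u × P v × Adj Y u v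

  induced⇒within : ∀ {S : Subset n} {u v} →
    Star (Adj (induced Y S)) u v → Star (Within (_∈ S)) (proj₁ u) (proj₁ v)
  induced⇒within = Star.gmap proj₁ λ {u} {v} e → proj₂ u , proj₂ v , e

  within⇒induced : ∀ {S : Subset n} {u v} (u∈S : u ∈ S) (v∈S : v ∈ S) →
    Star (Within (_∈ S)) u v → ∃[ w ] Star (Adj (induced Y S)) (u , u∈S) w × proj₁ w ≡ v
  within⇒induced u∈S v∈S ε = _ , ε , refl
  within⇒induced u∈S v∈S ((_ , w∈S , e) ◅ es)
    with x , es′ , eq ← within⇒induced w∈S v∈S es = x , e ◅ es′ , eq

-- Seatings

module _ {n : ℕ} where

  seat : Permutation n n → Fin n → ℕ
  seat σ u = toℕ (σ ⟨$⟩ˡ u)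

  seat-at : ∀ σ a → seat σ (σ ⟨$⟩ʳ a) ≡ toℕ a
  seat-at σ a = cong toℕ (inverseˡ σ)

  record Agree (j : ℕ) (σ τ : Permutation n n) : Set where
    constructor agree
    field at : ∀ a → toℕ a < j → σ ⟨$⟩ʳ a ≡ τ ⟨$⟩ʳ a

  open Agree public

  agree-refl : ∀ {j σ} → Agree j σ σ
  agree-refl = agree λ _ _ → refl

  agree-sym : ∀ {j σ τ} → Agree j σ τ → Agree j τ σ
  agree-sym eq = agree λ a a<j → sym (at eq a a<j)

  agree-trans : ∀ {j σ τ ρ} → Agree j σ τ → Agree j τ ρ → Agree j σ ρ
  agree-trans eq eq′ = agree λ a a<j → trans (at eq a a<j) (at eq′ a a<j)

  agree-pred : ∀ {j σ τ} → Agree (suc j) σ τ → Agree j σ τ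
  agree-pred eq = agree λ a a<j → at eq a (m<n⇒m<1+n a<j)

  agree-suc : ∀ {σ τ a} → Agree (toℕ a) σ τ → σ ⟨$⟩ʳ a ≡ τ ⟨$⟩ʳ a →
              Agree (suc (toℕ a)) σ τ
  agree-suc {σ} {τ} {a} eq eqₐ = agree λ c c≤a →
    [ at eq c , (λ c≡a → subst (λ c → σ ⟨$⟩ʳ c ≡ τ ⟨$⟩ʳ c) (sym (toℕ-injective c≡a)) eqₐ) ]′
      (m<1+n⇒m<n∨m≡n c≤a)

  -- Had `τ` put `u` below seat `j`, agreement would put `u` in that same seat under `σ`.
  agree-seat : ∀ {j σ τ u} → Agree j σ τ → j ≤ seat σ u → j ≤ seat τ u
  agree-seat {j} {σ} {τ} {u} eq j≤ = ≮⇒≥ λ lt → <⇒≱ lt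
    (subst (j ≤_)
      (trans (cong (seat σ) (sym (trans (at eq _ lt) (inverseʳ τ)))) (seat-at σ _)) j≤)

  -- `_∘ₚ_` applies its left factor first, so the people `u` and `v` trade places wherever they sit.
  exchange : Permutation n n → Fin n → Fin n → Permutation n n
  exchange σ u v = σ ∘ₚ transpose u v

  agree-exchange : ∀ {j σ₀ σ u v} → Agree j σ₀ σ → j ≤ seat σ₀ u → j ≤ seat σ₀ v →
                   Agree j σ₀ (exchange σ u v)
  agree-exchange {j} {σ₀} {σ} {u} {v} eq j≤u j≤v = agree λ a a<j → trans (at eq a a<j)
    (sym (transpose-fix u v (other a<j (agree-seat eq j≤u)) (other a<j (agree-seat eq j≤v))))
    where
    other : ∀ {a w} → toℕ a < j → j ≤ seat σ w → σ ⟨$⟩ʳ a ≢ w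
    other a<j j≤w refl = <⇒≱ a<j (subst (j ≤_) (seat-at σ _) j≤w)

  ⟨$⟩ʳ-injective : ∀ (σ : Permutation n n) → Injective _≡_ _≡_ (σ ⟨$⟩ʳ_)
  ⟨$⟩ʳ-injective σ eq = trans (sym (inverseˡ σ)) (trans (cong (σ ⟨$⟩ˡ_) eq) (inverseˡ σ))

  module _ (X Y : GraphOn n) where

    exchange-step : ∀ σ {u v} → Adj X (σ ⟨$⟩ˡ u) (σ ⟨$⟩ˡ v) → Adj Y u v →
                    Joined (FS X Y) σ (exchange σ u v)
    exchange-step σ {u} {v} x y = joined-step (FS X Y)
      {v = exchange σ u v}
      ( σ ⟨$⟩ˡ u , σ ⟨$⟩ˡ v , x
      , subst₂ (Adj Y) (sym (inverseʳ σ)) (sym (inverseʳ σ)) y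
      , trans (inverseʳ σ) (sym (trans (cong (transpose u v ⟨$⟩ʳ_) (inverseʳ σ)) (transpose-snd u v)))
      , trans (inverseʳ σ) (sym (trans (cong (transpose u v ⟨$⟩ʳ_) (inverseʳ σ)) (transpose-fst u v)))
      , λ c c≢a c≢b → sym (transpose-fix u v (c≢a ∘ moved) (c≢b ∘ moved)) )
      where
      moved : ∀ {c w} → σ ⟨$⟩ʳ c ≡ w → c ≡ σ ⟨$⟩ˡ w
      moved refl = sym (inverseˡ σ)

-- Edges of the lollipop

module _ (n k : ℕ) where

  tail-edge : ∀ {a b : Fin n} → toℕ a < n ∸ k → toℕ b ≡ suc (toℕ a) →
              Adj (Lollipop n k) a b
  -- Labels start at 1, so `toℕ a < n ∸ k` is by definition `label a ≤ n ∸ k`.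
  tail-edge a< b≡ = fwd (inj₁ (a< , cong suc b≡))

  head-edge : ∀ {a b : Fin n} → n ∸ k ≤ toℕ a → n ∸ k ≤ toℕ b → a ≢ b →
              Adj (Lollipop n k) a b
  head-edge {a} {b} ≤a ≤b a≢b with <-cmp (toℕ a) (toℕ b)
  ... | tri< lt _ _ = fwd (inj₂ (s≤s ≤a , s≤s lt))
  ... | tri≈ _ eq _ = contradiction (toℕ-injective eq) a≢b
  ... | tri> _ _ gt = bwd (inj₂ (s≤s ≤b , s≤s gt))

-- From connected induced subgraphs to a connected FS graph

module Sufficient {n k} (2≤k : 2 ≤ k) (k≤n : k ≤ n) (Y : GraphOn n)
  (conn : (S : Subset n) → ∣ S ∣ ≡ k → Connected (induced Y S)) where

  X = Lollipop n k

  Reach : Rel (Permutation n n) 0ℓ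
  Reach = Joined (FS X Y)

  Walk : ℕ → Permutation n n → Rel (Fin n) 0ℓ
  Walk j σ = Star (Within Y (λ u → j ≤ seat σ u))

  -- Since `2 ≤ k` and at least `k` people sit at `j` or beyond, some `k`-set of them contains both
  -- `u` and `v`; its induced subgraph supplies the walk.
  walk : ∀ {j σ u v} → j ≤ n ∸ k → j ≤ seat σ u → j ≤ seat σ v → Walk j σ u v
  walk {j} {σ} {u} {v} j≤n∸k j≤u j≤v =
    let S , pair⊆S , S⊆D , ∣S∣≡k = interpolate pair⊆D ∣pair∣≤k k≤∣D∣
        w , es , w≡v = conn S ∣S∣≡k (u , pair⊆S (p⊆p∪q ⁅ v ⁆ (x∈⁅x⁆ u)))
                                    (v , pair⊆S (q⊆p∪q ⁅ u ⁆ ⁅ v ⁆ (x∈⁅x⁆ v)))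
        S⇒beyond = λ {x} x∈S → ∈-filter⁻ beyond? {x} (S⊆D x∈S)
    in subst (Walk j σ u) w≡v
         (Star.map (λ (x∈S , y∈S , e) → S⇒beyond x∈S , S⇒beyond y∈S , e) (induced⇒within Y es))
    where
    beyond? : Decidable (λ u → j ≤ seat σ u)
    beyond? u = j ≤? seat σ u

    D = filter beyond?

    pair⊆D : ⁅ u ⁆ ∪ ⁅ v ⁆ ⊆ D
    pair⊆D x∈ with x∈p∪q⁻ ⁅ u ⁆ ⁅ v ⁆ x∈
    ... | inj₁ x∈u rewrite x∈⁅y⁆⇒x≡y u x∈u = ∈-filter⁺ beyond? j≤u
    ... | inj₂ x∈v rewrite x∈⁅y⁆⇒x≡y v x∈v = ∈-filter⁺ beyond? j≤v

    ∣pair∣≤k : ∣ ⁅ u ⁆ ∪ ⁅ v ⁆ ∣ ≤ k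
    ∣pair∣≤k = ≤-trans (∣p∪q∣≤∣p∣+∣q∣ ⁅ u ⁆ ⁅ v ⁆)
      (subst (_≤ k) (sym (cong₂ _+_ (∣⁅x⁆∣≡1 u) (∣⁅x⁆∣≡1 v))) 2≤k)

    j+k≤n : j + k ≤ n
    j+k≤n = subst (j + k ≤_) (m∸n+n≡m k≤n) (+-monoˡ-≤ k j≤n∸k)

    -- The seats from `j` to `j + k - 1`, whose occupants are `k` distinct members of `D`.
    far : Fin k → Fin n
    far i = inject≤ (j ↑ʳ i) j+k≤n

    toℕ-far : ∀ i → toℕ (far i) ≡ j + toℕ i
    toℕ-far i = trans (toℕ-inject≤ (j ↑ʳ i) j+k≤n) (toℕ-↑ʳ j i)

    k≤∣D∣ : k ≤ ∣ D ∣
    k≤∣D∣ = injection⇒≤∣S∣ {f = λ i → σ ⟨$⟩ʳ far i}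
      (λ {a} {b} eq → Finₚ.↑ʳ-injective j a b
        (Finₚ.inject≤-injective j+k≤n j+k≤n (j ↑ʳ a) (j ↑ʳ b) (⟨$⟩ʳ-injective σ eq)))
      (λ i → ∈-filter⁺ beyond?
        (subst (j ≤_) (sym (trans (seat-at σ (far i)) (toℕ-far i))) (m≤m+n j _)))

  head-step : ∀ {σ₀ σ u v} → Agree (n ∸ k) σ₀ σ → n ∸ k ≤ seat σ₀ u → n ∸ k ≤ seat σ₀ v →
              Adj Y u v → Reach σ (exchange σ u v)
  head-step {σ = σ} {u} {v} eq ≤u ≤v e =
    exchange-step X Y σ (head-edge n k (agree-seat eq ≤u) (agree-seat eq ≤v) seats≢) e
    where
    seats≢ : σ ⟨$⟩ˡ u ≢ σ ⟨$⟩ˡ v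
    seats≢ eq = adj-irrefl Y (trans (sym (inverseʳ σ)) (trans (cong (σ ⟨$⟩ʳ_) eq) (inverseʳ σ))) e

  -- The walk refers to a fixed seating σ₀ so that it stays valid along the
  -- recursion, where σ changes.
  head-exchange : ∀ {σ₀ u v} σ → Agree (n ∸ k) σ₀ σ → n ∸ k ≤ seat σ₀ v →
                  Walk (n ∸ k) σ₀ u v → u ≢ v → Reach σ (exchange σ u v)
  head-exchange σ _ _ ε u≢v = contradiction refl u≢v
  head-exchange {u = u} {v} σ eq ≤v (_◅_ {j = w} (≤u , ≤w , e) es) u≢v with w ≟ v
  ... | yes refl = head-step eq ≤u ≤w e
  ... | no w≢v =
    joined-trans (head-step eq ≤u ≤w e)
      (joined-trans (head-exchange σ₁ eq₁ ≤v es w≢v)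
        (joined-trans (head-step eq₂ ≤u ≤w e)
          (joined ε λ a → transpose-conj u≢v w≢u w≢v (σ ⟨$⟩ʳ a))))
    where
    σ₁ = exchange σ u w
    eq₁ = agree-exchange eq ≤u ≤w
    eq₂ = agree-exchange eq₁ ≤w ≤v
    w≢u : w ≢ u
    w≢u w≡u = adj-irrefl Y (sym w≡u) e

  Rearrangeable : ℕ → Set
  Rearrangeable j = ∀ {σ τ} → Agree j σ τ → Reach σ τ

  tail-bring : ∀ {σ₀ v} (a : Fin n) → toℕ a < n ∸ k → Rearrangeable (suc (toℕ a)) →
    ∀ σ → Agree (toℕ a) σ₀ σ → Walk (toℕ a) σ₀ (σ ⟨$⟩ʳ a) v →
    ∃[ τ ] Reach σ τ × Agree (toℕ a) σ₀ τ × τ ⟨$⟩ʳ a ≡ v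
  tail-bring {σ₀} {v} a a<n∸k rearr σ eq₀ = go σ eq₀ refl
    where
    b<n : suc (toℕ a) < n
    b<n = ≤-<-trans a<n∸k (∸-monoʳ-< (≤-trans (s≤s z≤n) 2≤k) k≤n)

    b : Fin n
    b = fromℕ< b<n

    b≡1+a : toℕ b ≡ suc (toℕ a)
    b≡1+a = toℕ-fromℕ< b<n

    go : ∀ {u} σ → Agree (toℕ a) σ₀ σ → σ ⟨$⟩ʳ a ≡ u → Walk (toℕ a) σ₀ u v →
      ∃[ τ ] Reach σ τ × Agree (toℕ a) σ₀ τ × τ ⟨$⟩ʳ a ≡ v
    go σ eq σa≡v ε = σ , joined ε (λ _ → refl) , eq , σa≡v
    go {u} σ eq σa≡u (_◅_ {j = w} (≤u , ≤w , e) es) =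
      let τ , r , eq′ , τa≡v = go σ₂ eq₂ σ₂a≡w es
      in τ , joined-trans (rearr eq₁) (joined-trans (exchange-step X Y σ₁ ab e) r) , eq′ , τa≡v
      where
      -- `w` trades with the occupant of `b`; both sit beyond `a`, so `rearr` realises this. Then
      -- `u` at `a` and `w` at `b` trade along the path edge.
      σ₁ = exchange σ w (σ ⟨$⟩ʳ b)
      σ₂ = exchange σ₁ u w

      seatOf : ∀ (ρ : Permutation n n) {c x} → ρ ⟨$⟩ʳ c ≡ x → c ≡ ρ ⟨$⟩ˡ x
      seatOf ρ refl = sym (inverseˡ ρ)

      -- The walk keeps `w` at seat `a` or beyond; seat `a` itself is excluded because its occupant
      -- `u` is adjacent to `w`.
      a<w : suc (toℕ a) ≤ seat σ w
      a<w = ≤∧≢⇒< (agree-seat eq ≤w) λ a≡ → adj-irrefl Y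
        (trans (sym σa≡u) (trans (cong (σ ⟨$⟩ʳ_) (toℕ-injective a≡)) (inverseʳ σ))) e

      eq₁ : Agree (suc (toℕ a)) σ σ₁
      eq₁ = agree-exchange agree-refl a<w (≤-reflexive (sym (trans (seat-at σ b) b≡1+a)))

      σ₁a≡u : σ₁ ⟨$⟩ʳ a ≡ u
      σ₁a≡u = trans (sym (at eq₁ a ≤-refl)) σa≡u

      ab : Adj X (σ₁ ⟨$⟩ˡ u) (σ₁ ⟨$⟩ˡ w)
      ab = subst₂ (Adj X) (seatOf σ₁ σ₁a≡u) (seatOf σ₁ (transpose-snd w (σ ⟨$⟩ʳ b)))
                          (tail-edge n k a<n∸k b≡1+a)

      σ₂a≡w : σ₂ ⟨$⟩ʳ a ≡ w
      σ₂a≡w = trans (cong (transpose u w ⟨$⟩ʳ_) σ₁a≡u) (transpose-fst u w)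

      eq₂ : Agree (toℕ a) σ₀ σ₂
      eq₂ = agree-exchange (agree-trans eq (agree-pred eq₁)) ≤u ≤w

  rearrange-step : (a : Fin n) → Rearrangeable (suc (toℕ a)) → Rearrangeable (toℕ a)
  rearrange-step a rearr {σ} {τ} eq = cases (n ∸ k ≤? toℕ a) (σ ⟨$⟩ʳ a ≟ τ ⟨$⟩ʳ a)
    where
    a≤u : toℕ a ≤ seat σ (σ ⟨$⟩ʳ a)
    a≤u = ≤-reflexive (sym (seat-at σ a))

    a≤v : toℕ a ≤ seat σ (τ ⟨$⟩ʳ a)
    a≤v = agree-seat (agree-sym eq) (≤-reflexive (sym (seat-at τ a)))

    cases : Dec (n ∸ k ≤ toℕ a) → Dec (σ ⟨$⟩ʳ a ≡ τ ⟨$⟩ʳ a) → Reach σ τ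
    cases _ (yes eqₐ) = rearr (agree-suc eq eqₐ)
    -- The walk may use everyone on the complete part, including people seated below `a`, so that
    -- `k` people are available. Conjugation puts these back: in the end only the two people
    -- exchanged have moved, both from `a` or beyond.
    cases (yes ≤a) (no neq) = joined-trans
      (head-exchange σ agree-refl (≤-trans ≤a a≤v)
        (walk {σ = σ} ≤-refl (≤-trans ≤a a≤u) (≤-trans ≤a a≤v)) neq)
      (rearr (agree-suc (agree-trans (agree-sym (agree-exchange agree-refl a≤u a≤v)) eq)
                        (transpose-fst (σ ⟨$⟩ʳ a) (τ ⟨$⟩ʳ a))))
    cases (no ≰a) (no _) =
      let a<n∸k = ≰⇒> ≰a
          σ′ , r , eq′ , eqₐ = tail-bring a a<n∸k rearr σ agree-refl
                                 (walk {σ = σ} (<⇒≤ a<n∸k) a≤u a≤v)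
      in joined-trans r (rearr (agree-suc (agree-trans (agree-sym eq′) eq) eqₐ))

  -- Downward induction on `j`, run on the number `d` of seats not yet settled; when `d` is zero,
  -- agreement is pointwise equality.
  rearrange : ∀ d j → j + d ≡ n → Rearrangeable j
  rearrange zero j j+0≡n eq = joined ε λ a →
    at eq a (subst (toℕ a <_) (sym (trans (sym (+-identityʳ j)) j+0≡n)) (toℕ<n a))
  rearrange (suc d) j j+1+d≡n =
    subst (λ j → Rearrangeable j) (toℕ-fromℕ< j<n) (rearrange-step (fromℕ< j<n)
      (subst (λ j → Rearrangeable (suc j)) (sym (toℕ-fromℕ< j<n))
        (rearrange d (suc j) (trans (sym (+-suc j d)) j+1+d≡n))))
    where
    j<n : j < n
    j<n = subst (suc j ≤_) (trans (sym (+-suc j d)) j+1+d≡n) (m≤m+n (suc j) d)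

  FS-connected : Connected (FS X Y)
  FS-connected σ τ with joined es eq ← rearrange n 0 refl {σ} {τ} (agree λ _ ()) = _ , es , eq

-- From a connected FS graph to connected induced subgraphs

module Necessary {n k} (k≤n : k ≤ n) (Y : GraphOn n) (S : Subset n) (∣S∣≡k : ∣ S ∣ ≡ k) where

  X = Lollipop n k

  Lowest : Permutation n n → Fin n → Set
  Lowest σ p = σ ⟨$⟩ʳ p ∈ S × (∀ a → toℕ a < toℕ p → σ ⟨$⟩ʳ a ∉ S)

  ∣∁S∣≡n∸k : ∣ ∁ S ∣ ≡ n ∸ k
  ∣∁S∣≡n∸k = trans (∣∁p∣≡n∸∣p∣ S) (cong (n ∸_) ∣S∣≡k)

  outsiders≤n∸k : ∀ {m} {f : Fin m → Fin n} σ → Injective _≡_ _≡_ f →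
                  (∀ i → σ ⟨$⟩ʳ f i ∉ S) → m ≤ n ∸ k
  outsiders≤n∸k σ f-inj f∉S = subst (_ ≤_) ∣∁S∣≡n∸k
    (injection⇒≤∣S∣ (f-inj ∘ ⟨$⟩ʳ-injective σ) (x∉p⇒x∈∁p ∘ f∉S))

  module _ (σ : Permutation n n) {p : Fin n}
           (below : ∀ a → toℕ a < toℕ p → σ ⟨$⟩ʳ a ∉ S) where

    p≤n : toℕ p ≤ n
    p≤n = <⇒≤ (toℕ<n p)

    seat-below : Fin (toℕ p) → Fin n
    seat-below i = inject≤ i p≤n

    seat-below<p : ∀ i → toℕ (seat-below i) < toℕ p
    seat-below<p i = subst (_< toℕ p) (sym (toℕ-inject≤ i p≤n)) (toℕ<n i)

    lowest≤n∸k : toℕ p ≤ n ∸ k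
    lowest≤n∸k = outsiders≤n∸k σ (λ {a} {b} → Finₚ.inject≤-injective p≤n p≤n a b)
                   λ i → below _ (seat-below<p i)

    -- The outsider at `b` is counted along with those in the `toℕ p` seats below `p`.
    lowest<n∸k : ∀ {b} → toℕ p < toℕ b → σ ⟨$⟩ʳ b ∉ S → toℕ p < n ∸ k
    lowest<n∸k {b} p<b b∉S = outsiders≤n∸k {f = f} σ f-inj
      λ { zero → b∉S ; (suc i) → below _ (seat-below<p i) }
      where
      f : Fin (suc (toℕ p)) → Fin n
      f zero    = b
      f (suc i) = seat-below i

      b≢ : ∀ i → b ≢ seat-below i
      b≢ i refl = <-asym p<b (seat-below<p i)

      f-inj : Injective _≡_ _≡_ f
      f-inj {zero}  {zero}  _  = refl
      f-inj {zero}  {suc i} eq = contradiction eq (b≢ i)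
      f-inj {suc i} {zero}  eq = contradiction (sym eq) (b≢ i)
      f-inj {suc i} {suc j} eq = cong suc (Finₚ.inject≤-injective p≤n p≤n i j eq)

  Kin : Rel (Fin n) 0ℓ
  Kin = Star (Within Y (_∈ S))

  -- Since only n ∸ k people are outside S, the seat p is at most n ∸ k, and
  -- strictly less when some outsider sits beyond p. So an exchange of the
  -- occupant of p with an outsider goes along a path edge and preserves the
  -- order on S: p's occupant can only be replaced by a neighbour in S.
  lowest-step : ∀ {σ τ p a b} → Lowest σ p → LollipopEdge n k (label a) (label b) →
    Adj Y (σ ⟨$⟩ʳ a) (σ ⟨$⟩ʳ b) → σ ⟨$⟩ʳ a ≡ τ ⟨$⟩ʳ b → σ ⟨$⟩ʳ b ≡ τ ⟨$⟩ʳ a →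
    (∀ c → c ≢ a → c ≢ b → σ ⟨$⟩ʳ c ≡ τ ⟨$⟩ʳ c) →
    ∃[ q ] Lowest τ q × Kin (σ ⟨$⟩ʳ p) (τ ⟨$⟩ʳ q)
  lowest-step {σ} {τ} {p} {a} {b} (p∈S , below) edge e ab ba fix =
    cases (<-cmp (toℕ a) (toℕ p)) (<-cmp (toℕ b) (toℕ p))
    where
    Goal = ∃[ q ] Lowest τ q × Kin (σ ⟨$⟩ʳ p) (τ ⟨$⟩ʳ q)

    a<b : toℕ a < toℕ b
    a<b = [ (λ { (_ , eq) → ≤-reflexive (sym (suc-injective eq)) })
          , (λ { (_ , lt) → s≤s⁻¹ lt }) ]′ edge

    -- An edge of the complete part has its lower end at `n ∸ k` or beyond, so only the path edge
    -- remains.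
    next : toℕ a < n ∸ k → toℕ b ≡ suc (toℕ a)
    next lt = [ suc-injective ∘ proj₂ , (λ { (le , _) → contradiction lt (≤⇒≯ (s≤s⁻¹ le)) }) ]′ edge

    fix-∉ : ∀ {c} → c ≢ a → c ≢ b → σ ⟨$⟩ʳ c ∉ S → τ ⟨$⟩ʳ c ∉ S
    fix-∉ c≢a c≢b = subst (_∉ S) (fix _ c≢a c≢b)

    away : ∀ {c} → toℕ c ≢ toℕ p → p ≢ c
    away ne eq = ne (cong toℕ (sym eq))

    stay : p ≢ a → p ≢ b → (∀ c → toℕ c < toℕ p → τ ⟨$⟩ʳ c ∉ S) → Goal
    stay p≢a p≢b below′ = p , (subst (_∈ S) (fix p p≢a p≢b) p∈S , below′)
                            , subst (Kin _) (fix p p≢a p≢b) ε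

    cases : _ → _ → Goal
    cases (tri< a<p a≢p _) (tri< b<p b≢p _) = stay (away a≢p) (away b≢p) below′
      where
      below′ : ∀ c → toℕ c < toℕ p → τ ⟨$⟩ʳ c ∉ S
      below′ c c<p with c ≟ a | c ≟ b
      ... | yes refl | _        = subst (_∉ S) ba (below b b<p)
      ... | no _     | yes refl = subst (_∉ S) ab (below a a<p)
      ... | no c≢a   | no c≢b   = fix-∉ c≢a c≢b (below c c<p)
    cases (tri< a<p _ _) (tri≈ _ b≡p _) with refl ← toℕ-injective b≡p =
      a , (subst (_∈ S) ba p∈S , below′) , subst (Kin _) ba ε
      where
      below′ : ∀ c → toℕ c < toℕ a → τ ⟨$⟩ʳ c ∉ S
      below′ c c<a = fix-∉ (<⇒≢ c<a ∘ cong toℕ) (<⇒≢ (<-trans c<a a<p) ∘ cong toℕ)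
                           (below c (<-trans c<a a<p))
    -- The only edge upwards from `a` ends at `a + 1`, which is at most `p`.
    cases (tri< a<p _ _) (tri> _ _ b>p) =
      contradiction (subst (_≤ toℕ p) (sym (next (<-≤-trans a<p (lowest≤n∸k σ below)))) a<p)
                    (<⇒≱ b>p)
    cases (tri≈ _ a≡p _) _ with refl ← toℕ-injective a≡p | σ ⟨$⟩ʳ b ∈? S
    ... | yes b∈S =
      a , (subst (_∈ S) ba b∈S , below′)
        , (p∈S , subst (_∈ S) ba b∈S , subst (Adj Y _) ba e) ◅ ε
      where
      below′ : ∀ c → toℕ c < toℕ a → τ ⟨$⟩ʳ c ∉ S
      below′ c c<a = fix-∉ (<⇒≢ c<a ∘ cong toℕ) (<⇒≢ (<-trans c<a a<b) ∘ cong toℕ) (below c c<a)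
    ... | no b∉S = b , (subst (_∈ S) ab p∈S , below′) , subst (Kin _) ab ε
      where
      below′ : ∀ c → toℕ c < toℕ b → τ ⟨$⟩ʳ c ∉ S
      below′ c c<b with c ≟ a
      ... | yes refl = subst (_∉ S) ba b∉S
      -- The outsider at `b` forces `b` to be seat `a + 1`, so a seat below `b` other than `a` is
      -- below `a`.
      ... | no c≢a = fix-∉ c≢a (<⇒≢ c<b ∘ cong toℕ) (below c
        (≤∧≢⇒< (s≤s⁻¹ (subst (toℕ c <_) (next (lowest<n∸k σ below a<b b∉S)) c<b))
               (c≢a ∘ toℕ-injective)))
    cases (tri> _ a≢p a>p) (tri> _ b≢p b>p) = stay (away a≢p) (away b≢p) λ c c<p →
      fix-∉ (<⇒≢ (<-trans c<p a>p) ∘ cong toℕ) (<⇒≢ (<-trans c<p b>p) ∘ cong toℕ) (below c c<p)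
    cases (tri> _ _ a>p) (tri≈ _ b≡p _) = contradiction a<b (<⇒≯ (subst (_< toℕ a) (sym b≡p) a>p))
    cases (tri> _ _ a>p) (tri< b<p _ _) = contradiction a<b (<⇒≯ (<-trans b<p a>p))

  lowest-path : ∀ {σ τ p} → Lowest σ p → Star (FSAdj X Y) σ τ →
    ∃[ q ] Lowest τ q × Kin (σ ⟨$⟩ʳ p) (τ ⟨$⟩ʳ q)
  lowest-path {p = p} low ε = p , low , ε
  lowest-path {σ} low (_◅_ {j = ρ} (a , b , fwd edge , e , ab , ba , fix) es)
    with p′ , low′ , kin ← lowest-step {σ} {ρ} low edge e ab ba fix
    with q , low″ , kin′ ← lowest-path low′ es = q , low″ , kin ◅◅ kin′
  lowest-path {σ} low (_◅_ {j = ρ} (a , b , bwd edge , e , ab , ba , fix) es)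
    with p′ , low′ , kin ← lowest-step {σ} {ρ} low edge (adj-sym Y e) ba ab
                             (λ c c≢b c≢a → fix c c≢a c≢b)
    with q , low″ , kin′ ← lowest-path low′ es = q , low″ , kin ◅◅ kin′

  induced-connected : Connected (FS X Y) → Connected (induced Y S)
  induced-connected conn (u , u∈S) (v , v∈S) =
    let ρ , es , ρ≈τ = conn (seat-first u) (seat-first v)
        ρ-first = trans (ρ≈τ first) (transpose-fst first v)
        q , (_ , below) , kin = lowest-path (lowest-first u∈S) es
        -- Under `ρ` the first seat holds `v`, a member of `S`, so the lowest seat `q` cannot lie
        -- beyond it.
        q≡first = toℕ-injective (trans
          (n≤0⇒n≡0 (≮⇒≥ λ 0<q → below first (subst (_< toℕ q) (sym first≡0) 0<q)
                                            (subst (_∈ S) (sym ρ-first) v∈S)))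
          (sym first≡0))
    in within⇒induced Y u∈S v∈S
         (subst₂ Kin (transpose-fst first u) (trans (cong (ρ ⟨$⟩ʳ_) q≡first) ρ-first) kin)
    where
    0<n : 0 < n
    0<n = ≤-<-trans z≤n (toℕ<n u)

    first : Fin n
    first = fromℕ< 0<n

    first≡0 : toℕ first ≡ 0
    first≡0 = toℕ-fromℕ< 0<n

    seat-first : Fin n → Permutation n n
    seat-first w = transpose first w

    lowest-first : ∀ {w} → w ∈ S → Lowest (seat-first w) first
    lowest-first {w} w∈S = subst (_∈ S) (sym (transpose-fst first w)) w∈S ,
      λ a a<0 → contradiction (subst (toℕ a <_) first≡0 a<0) λ ()

-- Induced subgraphs as deletions of complements

complement-size : ∀ {n k} → k ≤ n → (S : Subset n) → suc ∣ S ∣ ≡ n ∸ k + 1 → ∣ ∁ S ∣ ≡ k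
complement-size {n} {k} k≤n S eq = trans (∣∁p∣≡n∸∣p∣ S)
  (trans (cong (n ∸_) (suc-injective (trans eq (+-comm (n ∸ k) 1)))) (m∸[m∸n]≡n k≤n))

theorem1p6 : (n k : ℕ) → 2 ≤ k → k ≤ n → (Y : GraphOn n) →
    (Connected (FS (Lollipop n k) Y) ⇔ ((S : Subset n) → ∣ S ∣ ≡ k → Connected (induced Y S)))
    × (((S : Subset n) → ∣ S ∣ ≡ k → Connected (induced Y S)) ⇔ ((n ∸ k + 1) -Connected Y))
theorem1p6 n k 2≤k k≤n Y =
  mk⇔ (λ conn S ∣S∣≡k → Necessary.induced-connected k≤n Y S ∣S∣≡k conn)
      (Sufficient.FS-connected 2≤k k≤n Y) ,
  mk⇔ (λ conn S eq → conn (∁ S) (complement-size k≤n S eq))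
      -- Deleting `∁ S` leaves the subgraph induced on the double complement, which is carried back
      -- to `S`.
      (λ conn S ∣S∣≡k → subst (Connected ∘ induced Y)
        (¬-involutive (∪-∩-booleanAlgebra n) S)
        (conn (∁ S) (trans (cong suc (trans (∣∁p∣≡n∸∣p∣ S) (cong (n ∸_) ∣S∣≡k)))
                           (+-comm 1 (n ∸ k)))))
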